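{- Let $p\ge 5$ be a prime, let $C,D\in\mathbb{F}_p$, let $$f(x,y,z)=x^2+y^2+z^2-xyz+C(x+y+z)-D,$$ and put $D_\bullet=4-2C-\frac{C^2}{4}\in\mathbb{F}_p$. Let $N_1(f)$ be the number of $(x,y,z)\in\mathbb{F}_p^3$ with $f(x,y,z)=0$ and $(\partial_z f)(x,y,z)=0$. Then the following hold. (i) If $D=D_\bullet$, then $N_1(f)=\big(3+\llbracket C=0\rrbracket\big)p-4+\llbracket C=8\rrbracket$. (ii) If $D\ne D_\bullet$, then $$N_1(f)=p-3+\sum_{x\in\mathbb{F}_p}\sigma(\lambda(x)),$$ where $\lambda(x)$ is the cubic $$\lambda(x)=x^3-(D-D_\bullet)x^2+\Big(\frac{C-8}{2}\cdot x+4(D-D_\bullet)\Big)^2.$$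
   Context: $\sigma:\mathbb{F}_p\to\{ -1,0,1\}\subset\mathbb{Z}$ denotes the quadratic character: $\sigma(a)=1$ if $a$ is a nonzero square, $\sigma(a)=-1$ if $a$ is a non-square, $\sigma(0)=0$. The Iverson bracket $\llbracket \mathcal{S}\rrbracket$ is $1$ if the statement $\mathcal{S}$ is true and $0$ otherwise; equalities such as $C=8$ are in $\mathbb{F}_p$. -}

module Defs where

open import Algebra.Bundles.Raw using (RawRing)
import Algebra.Definitions.RawSemiring as RawSemiringDefinitions
open import Data.Bool.Base using (if_then_else_)
open import Data.Fin.Base using (Fin; zero; suc; toℕ)
open import Data.Fin.Properties using (any?) renaming (_≟_ to _≟ᶠ_)
open import Data.Integer.Base using (ℤ; 0ℤ; 1ℤ; -1ℤ)
import Data.Integer.Properties as ℤ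
open import Data.List.Base using (List; allFin; cartesianProduct; filter; length)
import Data.Nat.Base as ℕ
open ℕ using (ℕ; NonZero)
open import Data.Nat.DivMod using (_mod_)
open import Data.Product.Base using (∃; _×_; _,_)
open import Data.Vec.Base using (Vec; []; _∷_; lookup)
open import Level using (0ℓ)
open import Relation.Binary.Definitions using (DecidableEquality)
open import Relation.Binary.PropositionalEquality using (_≡_)
open import Relation.Nullary.Decidable using (Dec; yes; no; does; _×-dec_)
open import Relation.Unary using (Decidable)

open import Algebra.Properties.CommutativeMonoid.Sum ℤ.+-0-commutativeMonoid public
  using (sum)

-- The Iverson bracket takes a decision of the statement rather than the
-- statement itself.
⟦_⟧ : {A : Set} → Dec A → ℤ
⟦ d ⟧ = if does d then 1ℤ else 0ℤ

-- 𝔽ₚ as the residues 0, …, p - 1.  Primality is not needed for the definitions,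
-- so it is left to the statements that use them.
module ResidueField (p : ℕ) .{{_ : NonZero p}} where

  infix  4 _≟_
  infixl 6 _+_ _-_
  infixl 7 _*_ _/_
  infix  8 -_
  infix  9 _⁻¹

  𝔽 : Set
  𝔽 = Fin p

  _≟_ : DecidableEquality 𝔽
  _≟_ = _≟ᶠ_

  #_ : ℕ → 𝔽
  # n = n mod p

  _+_ : 𝔽 → 𝔽 → 𝔽
  a + b = # (toℕ a ℕ.+ toℕ b)

  _*_ : 𝔽 → 𝔽 → 𝔽
  a * b = # (toℕ a ℕ.* toℕ b)

  -_ : 𝔽 → 𝔽
  - a = # (p ℕ.∸ toℕ a)

  _-_ : 𝔽 → 𝔽 → 𝔽
  a - b = a + - b

  rawRing : RawRing 0ℓ 0ℓ
  rawRing = record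
    { Carrier = 𝔽 ; _≈_ = _≡_
    ; _+_ = _+_ ; _*_ = _*_ ; -_ = -_ ; 0# = # 0 ; 1# = # 1
    }

  open RawSemiringDefinitions (RawRing.rawSemiring rawRing) public using (_^_)

  -- The value at elements without an inverse is junk (zero).
  _⁻¹ : 𝔽 → 𝔽
  a ⁻¹ with any? (λ b → a * b ≟ # 1)
  ... | yes (b , _) = b
  ... | no  _       = # 0

  _/_ : 𝔽 → 𝔽 → 𝔽
  a / b = a * b ⁻¹

  IsSquare : 𝔽 → Set
  IsSquare a = ∃ λ b → b * b ≡ a

  isSquare? : Decidable IsSquare
  isSquare? a = any? (λ b → b * b ≟ a)

  σ : 𝔽 → ℤ
  σ a = if does (a ≟ # 0) then 0ℤ
        else if does (isSquare? a) then 1ℤ else -1ℤ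

  infixl 6 _⊕_ _⊖_
  infixl 7 _⊗_

  -- Polynomials in n variables over 𝔽, given by expressions: distinct
  -- expressions may denote the same polynomial.
  data Poly (n : ℕ) : Set where
    con : 𝔽 → Poly n
    var : Fin n → Poly n
    _⊕_ _⊖_ _⊗_ : Poly n → Poly n → Poly n

  eval : ∀ {n} → Poly n → Vec 𝔽 n → 𝔽
  eval (con a) v = a
  eval (var i) v = lookup v i
  eval (g ⊕ h) v = eval g v + eval h v
  eval (g ⊖ h) v = eval g v - eval h v
  eval (g ⊗ h) v = eval g v * eval h v

  -- Formal partial derivative with respect to the i-th variable.
  ∂ : ∀ {n} → Fin n → Poly n → Poly n
  ∂ i (con a) = con (# 0)
  ∂ i (var j) = con (if does (i ≟ᶠ j) then # 1 else # 0)
  ∂ i (g ⊕ h) = ∂ i g ⊕ ∂ i h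
  ∂ i (g ⊖ h) = ∂ i g ⊖ ∂ i h
  ∂ i (g ⊗ h) = ∂ i g ⊗ h ⊕ g ⊗ ∂ i h

  pattern X = var zero
  pattern Y = var (suc zero)
  pattern Z = var (suc (suc zero))

  f : 𝔽 → 𝔽 → Poly 3
  f C D = X ⊗ X ⊕ Y ⊗ Y ⊕ Z ⊗ Z ⊖ X ⊗ Y ⊗ Z ⊕ con C ⊗ (X ⊕ Y ⊕ Z) ⊖ con D

  𝔽³ : List (𝔽 × 𝔽 × 𝔽)
  𝔽³ = cartesianProduct (allFin p) (cartesianProduct (allFin p) (allFin p))

  CriticalZero : Poly 3 → 𝔽 × 𝔽 × 𝔽 → Set
  CriticalZero g (x , y , z) =
    eval g v ≡ # 0 × eval (∂ (suc (suc zero)) g) v ≡ # 0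
    where v = x ∷ y ∷ z ∷ []

  criticalZero? : ∀ g → Decidable (CriticalZero g)
  criticalZero? g (x , y , z) =
    (eval g v ≟ # 0) ×-dec (eval (∂ (suc (suc zero)) g) v ≟ # 0)
    where v = x ∷ y ∷ z ∷ []

  N₁ : Poly 3 → ℕ
  N₁ g = length (filter (criticalZero? g) 𝔽³)

  D• : 𝔽 → 𝔽
  D• C = # 4 - # 2 * C - C ^ 2 / # 4

  -- The cubic λ(x).
  cubic : 𝔽 → 𝔽 → 𝔽 → 𝔽
  cubic C D x =
    x ^ 3 - (D - D• C) * x ^ 2
      + ((C - # 8) / # 2 * x + # 4 * (D - D• C)) ^ 2

-- With x + 2 = u, y + 2 = v and E = D - D•, eliminating z = (xy - C)/2 from f = 0
-- leaves the curve u v ((u - 4)(v - 4) - 2C) + 4E = 0, whose points are counted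
-- fibrewise over u.  For E = 0 it splits into two lines and a hyperbola.  For
-- E ≠ 0 put w = 4E / u: in the fibre the equation is quadratic in v, with
-- discriminant the cubic at w up to nonzero squares, so the fibre has
-- 1 + σ(λ(w)) points.  The exceptions are w = 0, where u = 0 and the fibre is
-- empty although λ(0) is a nonzero square, and w = E, where u = 4, the equation
-- is linear and the fibre has only σ(λ(E)) points; hence the correction -3.

module Submission where

open import Defs
open import Algebra.Bundles using (CommutativeRing)
import Algebra.Properties.Ring
import Algebra.Properties.Semiring.Sum
import Algebra.Solver.Ring
open import Algebra.Solver.Ring.AlmostCommutativeRing
  using (_-Raw-AlmostCommutative⟶_; fromCommutativeRing)
open import Algebra.Structures using (IsCommutativeRing)
open import Data.Fin.Base using (Fin; zero; suc; toℕ)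
open import Data.Fin.Permutation using (permutation)
open import Data.Fin.Properties using (any?; toℕ<n; toℕ-injective; toℕ-fromℕ<)
  renaming (_≟_ to _≟ᶠ_)
open import Data.Integer.Base as ℤ using (ℤ; +_; -[1+_]; 0ℤ; 1ℤ)
import Data.Integer.Properties as ℤ
open import Data.Integer.Solver using (module +-*-Solver)
open import Data.List.Base
  using (List; []; _∷_; _++_; allFin; cartesianProduct; filter; length; map; tabulate)
open import Data.List.Properties using (filter-++; length-++)
import Data.Maybe.Base as Maybe
import Data.Nat.Base as ℕ
open import Data.Nat.Base using (ℕ; NonZero; _≤_; _<_)
open import Data.Nat.Coprimality using (prime⇒coprime; coprime-Bézout)
open import Data.Nat.DivMod
  using (_%_; m%n<n; m<n⇒m%n≡m; n%n≡0; %-distribˡ-+; %-distribˡ-*)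
open import Data.Nat.GCD using (module Bézout)
open import Data.Nat.Primality using (Prime)
import Data.Nat.Properties as ℕ
open import Data.Product.Base using (_×_; _,_; ∃)
open import Data.Sum.Base using (_⊎_; inj₁; inj₂; [_,_]′)
open import Data.Vec.Base using ([]; _∷_)
open import Function.Base using (_∘_)
open import Level using (0ℓ)
open import Relation.Binary.PropositionalEquality
  using (_≡_; _≢_; refl; sym; trans; cong; cong₂; subst; isEquivalence; module ≡-Reasoning)
open import Relation.Nullary.Decidable using (Dec; yes; no; dec⇒maybe)
open import Relation.Nullary.Negation using (¬_; contradiction)
open import Relation.Unary using (Decidable)

open import Algebra.Properties.Semiring.Sum ℤ.+-*-semiring
  using (sum-cong-≗; ∑-distrib-+; sum-permute; *-distribˡ-sum)
open Bézout using (+-; -+)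
open +-*-Solver using ()
  renaming (Polynomial to ℤ-Polynomial; solve to solveℤ; con to conℤ; _:=_ to _≐_; _:+_ to _⊞_; _:-_ to _⊟_; _:*_ to _⊠_)

-- A zero of f at which the z-derivative vanishes is a double root in z, so the curve is the
-- vanishing of the z-discriminant. That discriminant is the product of x + 2, y + 2 and (x - 2)(y -
-- 2) - 2C plus the constant 4D + C² + 8C - 16, and D• is the value of D that kills this constant.
-- The obstacle is the exceptional fibres, whose positions depend on the parameters and may collide.
-- For E = 0 they lie over x = -2, x = 2 and x = 2 - C/2; the last falls on the second when C = 0
-- and on the first when C = 8, and these collisions are behind the brackets in (i). Instead of
-- removing points from the range of summation, each fibre count is given for every x as a main term
-- plus multiples of Iverson brackets, so that collisions are settled pointwise and the summation is
-- linear. For E ≠ 0 the convention 0⁻¹ = 0 turns w = 4E / u into a permutation of all of 𝔽, which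
-- puts the empty fibre u = 0 at w = 0.

private variable
  A B C : Set
  n : ℕ

-- Iverson brackets and finite integer sums

⟦⟧-true : (d : Dec A) → A → ⟦ d ⟧ ≡ 1ℤ
⟦⟧-true (yes _) a = refl
⟦⟧-true (no ¬a) a = contradiction a ¬a

⟦⟧-false : (d : Dec A) → ¬ A → ⟦ d ⟧ ≡ 0ℤ
⟦⟧-false (yes a) ¬a = contradiction a ¬a
⟦⟧-false (no _)  ¬a = refl

⟦⟧-cong : (d : Dec A) (e : Dec B) → (A → B) → (B → A) → ⟦ d ⟧ ≡ ⟦ e ⟧
⟦⟧-cong (yes a) e to from = sym (⟦⟧-true e (to a))
⟦⟧-cong (no ¬a) e to from = sym (⟦⟧-false e (¬a ∘ from))

-- Counts a solution set that splits into two branches; the last hypothesis excludes double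
-- counting, since a bracket never exceeds one.
⟦⟧-⊎ : (d : Dec A) (e : Dec B) (g : Dec C) →
       (A → B ⊎ C) → (B → A) → (C → A) → ¬ (B × C) → ⟦ d ⟧ ≡ ⟦ e ⟧ ℤ.+ ⟦ g ⟧
⟦⟧-⊎ d (yes b) g split l r ¬both =
  trans (⟦⟧-true d (l b)) (sym (cong (λ i → 1ℤ ℤ.+ i) (⟦⟧-false g (λ c → ¬both (b , c)))))
⟦⟧-⊎ d (no ¬b) g split l r ¬both =
  trans (⟦⟧-cong d g (λ a → [ (λ b → contradiction b ¬b) , (λ c → c) ]′ (split a)) r)
        (sym (ℤ.+-identityˡ ⟦ g ⟧))

sum-const : ∀ n (i : ℤ) → sum {n} (λ _ → i) ≡ + n ℤ.* i
sum-const ℕ.zero    i = refl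
sum-const (ℕ.suc n) i = begin
  i ℤ.+ sum {n} (λ _ → i)  ≡⟨ cong (λ j → i ℤ.+ j) (sum-const n i) ⟩
  i ℤ.+ + n ℤ.* i          ≡⟨ ℤ.suc-* (+ n) i ⟨
  + ℕ.suc n ℤ.* i          ∎
  where open ≡-Reasoning

sum-zero : {g : Fin n → ℤ} → (∀ i → g i ≡ 0ℤ) → sum g ≡ 0ℤ
sum-zero {n} eq = trans (sum-cong-≗ eq) (trans (sum-const n 0ℤ) (ℤ.*-zeroʳ (+ n)))

sum-δ : (a : Fin n) → sum (λ i → ⟦ i ≟ᶠ a ⟧) ≡ 1ℤ
sum-δ {ℕ.suc n} zero    = cong (λ i → 1ℤ ℤ.+ i) (sum-zero {n} (λ _ → refl))
sum-δ           (suc a) = trans (ℤ.+-identityˡ _) (sum-δ a)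

sum-scaled-δ : ∀ i (a : Fin n) → sum (λ j → i ℤ.* ⟦ j ≟ᶠ a ⟧) ≡ i
sum-scaled-δ i a = begin
  sum (λ j → i ℤ.* ⟦ j ≟ᶠ a ⟧)  ≡⟨ *-distribˡ-sum i (λ j → ⟦ j ≟ᶠ a ⟧) ⟨
  i ℤ.* sum (λ j → ⟦ j ≟ᶠ a ⟧)  ≡⟨ cong (λ j → i ℤ.* j) (sum-δ a) ⟩
  i ℤ.* 1ℤ                      ≡⟨ ℤ.*-identityʳ i ⟩
  i                             ∎
  where open ≡-Reasoning

sum-unique : {P : Fin n → Set} (P? : Decidable P) (a : Fin n) →
             (∀ i → P i → i ≡ a) → P a → sum (λ i → ⟦ P? i ⟧) ≡ 1ℤ
sum-unique {P = P} P? a unique Pa = trans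
  (sum-cong-≗ λ i → ⟦⟧-cong (P? i) (i ≟ᶠ a) (unique i) (λ i≡a → subst P (sym i≡a) Pa))
  (sum-δ a)

sum-none : {P : Fin n → Set} (P? : Decidable P) →
           (∀ i → ¬ P i) → sum (λ i → ⟦ P? i ⟧) ≡ 0ℤ
sum-none P? ¬P = sum-zero λ i → ⟦⟧-false (P? i) (¬P i)

sum-all : ∀ n {P : Fin n → Set} (P? : Decidable P) →
          (∀ i → P i) → sum (λ i → ⟦ P? i ⟧) ≡ + n
sum-all n P? all = trans (sum-cong-≗ λ i → ⟦⟧-true (P? i) (all i))
                   (trans (sum-const n 1ℤ) (ℤ.*-identityʳ (+ n)))

sum-bijection : (g : Fin n → ℤ) (to from : Fin n → Fin n) →
                (∀ i → to (from i) ≡ i) → (∀ i → from (to i) ≡ i) →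
                sum g ≡ sum (g ∘ to)
sum-bijection g to from to-from from-to = sum-permute g (permutation to from to-from from-to)

-- From lengths of filtered lists to sums of brackets

length-filter-tabulate : {P : A → Set} (P? : Decidable P) (g : Fin n → A) →
  + length (filter P? (tabulate g)) ≡ sum (λ i → ⟦ P? (g i) ⟧)
length-filter-tabulate {n = ℕ.zero}  P? g = refl
length-filter-tabulate {n = ℕ.suc n} P? g with P? (g zero)
... | yes _ = cong (λ i → 1ℤ ℤ.+ i) (length-filter-tabulate P? (g ∘ suc))
... | no  _ = trans (length-filter-tabulate P? (g ∘ suc)) (sym (ℤ.+-identityˡ _))

length-filter-map : {P : B → Set} (P? : Decidable P) (g : A → B) (xs : List A) →
  length (filter P? (map g xs)) ≡ length (filter (P? ∘ g) xs)
length-filter-map P? g []       = refl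
length-filter-map P? g (x ∷ xs) with P? (g x)
... | yes _ = cong ℕ.suc (length-filter-map P? g xs)
... | no  _ = length-filter-map P? g xs

-- `allFin` tabulates the identity, but the recursion passes from `g` to `g ∘ suc`, so the rows are
-- indexed by an arbitrary `g`.
length-filter-cartesianProduct :
  {P : A × B → Set} (P? : Decidable P) (g : Fin n → A) (ys : List B) →
  + length (filter P? (cartesianProduct (tabulate g) ys)) ≡
  sum (λ i → + length (filter (λ y → P? (g i , y)) ys))
length-filter-cartesianProduct {n = ℕ.zero}  P? g ys = refl
length-filter-cartesianProduct {n = ℕ.suc n} P? g ys = begin
  + length (filter P? (row ++ rest))
    ≡⟨ cong (+_ ∘ length) (filter-++ P? row rest) ⟩
  + length (filter P? row ++ filter P? rest)
    ≡⟨ cong +_ (length-++ (filter P? row)) ⟩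
  + (length (filter P? row) ℕ.+ length (filter P? rest))
    ≡⟨ ℤ.pos-+ (length (filter P? row)) (length (filter P? rest)) ⟩
  + length (filter P? row) ℤ.+ + length (filter P? rest)
    ≡⟨ cong₂ ℤ._+_ (cong +_ (length-filter-map P? (g zero ,_) ys))
                   (length-filter-cartesianProduct P? (g ∘ suc) ys) ⟩
  sum (λ i → + length (filter (λ y → P? (g i , y)) ys)) ∎
  where
  open ≡-Reasoning
  row  = map (g zero ,_) ys
  rest = cartesianProduct (tabulate (g ∘ suc)) ys

-- The residues modulo p as a commutative ring

module ResidueRing (p : ℕ) .{{_ : NonZero p}} where
  open ResidueField p
  open ≡-Reasoning

  toℕ-# : ∀ n → toℕ (# n) ≡ n % p
  toℕ-# n = toℕ-fromℕ< (m%n<n n p)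

  #-cong : ∀ {m n} → m % p ≡ n % p → # m ≡ # n
  #-cong {m} {n} eq = toℕ-injective (trans (toℕ-# m) (trans eq (sym (toℕ-# n))))

  #-toℕ : ∀ a → # toℕ a ≡ a
  #-toℕ a = toℕ-injective (trans (toℕ-# (toℕ a)) (m<n⇒m%n≡m (toℕ<n a)))

  -- A sum in 𝔽 is by definition the residue of a sum in ℕ. Once a bare element is rewritten as
  -- `# toℕ a`, this and its multiplicative twin let the ring laws descend from ℕ.
  #-+ : ∀ m n → # (m ℕ.+ n) ≡ # m + # n
  #-+ m n rewrite toℕ-# m | toℕ-# n = #-cong (%-distribˡ-+ m n p)

  #-* : ∀ m n → # (m ℕ.* n) ≡ # m * # n
  #-* m n rewrite toℕ-# m | toℕ-# n = #-cong (%-distribˡ-* m n p)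

  #p≡#0 : # p ≡ # 0
  #p≡#0 = #-cong (trans (n%n≡0 p) (sym (m<n⇒m%n≡m (ℕ.>-nonZero⁻¹ p))))

  +-comm : ∀ a b → a + b ≡ b + a
  +-comm a b = cong #_ (ℕ.+-comm (toℕ a) (toℕ b))

  *-comm : ∀ a b → a * b ≡ b * a
  *-comm a b = cong #_ (ℕ.*-comm (toℕ a) (toℕ b))

  +-assoc : ∀ a b c → (a + b) + c ≡ a + (b + c)
  +-assoc a b c = begin
    (a + b) + c               ≡⟨ cong (λ x → a + b + x) (#-toℕ c) ⟨
    (a + b) + # k             ≡⟨ #-+ (i ℕ.+ j) k ⟨
    # (i ℕ.+ j ℕ.+ k)         ≡⟨ cong #_ (ℕ.+-assoc i j k) ⟩
    # (i ℕ.+ (j ℕ.+ k))       ≡⟨ #-+ i (j ℕ.+ k) ⟩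
    # i + (b + c)             ≡⟨ cong (_+ (b + c)) (#-toℕ a) ⟩
    a + (b + c)               ∎
    where i = toℕ a ; j = toℕ b ; k = toℕ c

  *-assoc : ∀ a b c → (a * b) * c ≡ a * (b * c)
  *-assoc a b c = begin
    (a * b) * c               ≡⟨ cong (a * b *_) (#-toℕ c) ⟨
    (a * b) * # k             ≡⟨ #-* (i ℕ.* j) k ⟨
    # (i ℕ.* j ℕ.* k)         ≡⟨ cong #_ (ℕ.*-assoc i j k) ⟩
    # (i ℕ.* (j ℕ.* k))       ≡⟨ #-* i (j ℕ.* k) ⟩
    # i * (b * c)             ≡⟨ cong (_* (b * c)) (#-toℕ a) ⟩
    a * (b * c)               ∎
    where i = toℕ a ; j = toℕ b ; k = toℕ c

  *-distribˡ-+ : ∀ a b c → a * (b + c) ≡ a * b + a * c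
  *-distribˡ-+ a b c = begin
    a * (b + c)               ≡⟨ cong (_* (b + c)) (#-toℕ a) ⟨
    # i * # (j ℕ.+ k)         ≡⟨ #-* i (j ℕ.+ k) ⟨
    # (i ℕ.* (j ℕ.+ k))       ≡⟨ cong #_ (ℕ.*-distribˡ-+ i j k) ⟩
    # (i ℕ.* j ℕ.+ i ℕ.* k)   ≡⟨ #-+ (i ℕ.* j) (i ℕ.* k) ⟩
    a * b + a * c             ∎
    where i = toℕ a ; j = toℕ b ; k = toℕ c

  +-identityˡ : ∀ a → # 0 + a ≡ a
  +-identityˡ a = begin
    # 0 + a        ≡⟨ cong (λ x → # 0 + x) (#-toℕ a) ⟨
    # 0 + # toℕ a  ≡⟨ #-+ 0 (toℕ a) ⟨
    # toℕ a        ≡⟨ #-toℕ a ⟩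
    a              ∎

  *-identityˡ : ∀ a → # 1 * a ≡ a
  *-identityˡ a = begin
    # 1 * a            ≡⟨ cong (# 1 *_) (#-toℕ a) ⟨
    # 1 * # toℕ a      ≡⟨ #-* 1 (toℕ a) ⟨
    # (1 ℕ.* toℕ a)    ≡⟨ cong #_ (ℕ.*-identityˡ (toℕ a)) ⟩
    # toℕ a            ≡⟨ #-toℕ a ⟩
    a                  ∎

  -‿inverseʳ : ∀ a → a + - a ≡ # 0
  -‿inverseʳ a = begin
    a + - a                       ≡⟨ cong (_+ - a) (#-toℕ a) ⟨
    # toℕ a + # (p ℕ.∸ toℕ a)     ≡⟨ #-+ (toℕ a) (p ℕ.∸ toℕ a) ⟨
    # (toℕ a ℕ.+ (p ℕ.∸ toℕ a))   ≡⟨ cong #_ (ℕ.m+[n∸m]≡n (ℕ.<⇒≤ (toℕ<n a))) ⟩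
    # p                           ≡⟨ #p≡#0 ⟩
    # 0                           ∎

  isCommutativeRing : IsCommutativeRing _≡_ _+_ _*_ (λ a → - a) (# 0) (# 1)
  isCommutativeRing = record
    { isRing = record
      { +-isAbelianGroup = record
        { isGroup = record
          { isMonoid = record
            { isSemigroup = record
              { isMagma = record { isEquivalence = isEquivalence ; ∙-cong = cong₂ _+_ }
              ; assoc = +-assoc
              }
            ; identity = +-identityˡ , λ a → trans (+-comm a (# 0)) (+-identityˡ a)
            }
          ; inverse = (λ a → trans (+-comm (- a) a) (-‿inverseʳ a)) , -‿inverseʳ
          ; ⁻¹-cong = cong (λ x → - x)
          }
        ; comm = +-comm
        }
      ; *-cong = cong₂ _*_
      ; *-assoc = *-assoc
      ; *-identity = *-identityˡ , λ a → trans (*-comm a (# 1)) (*-identityˡ a)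
      ; distrib = *-distribˡ-+ , λ a b c → trans (*-comm (b + c) a)
          (trans (*-distribˡ-+ a b c) (cong₂ _+_ (*-comm a b) (*-comm a c)))
      }
    ; *-comm = *-comm
    }

  commutativeRing : CommutativeRing 0ℓ 0ℓ
  commutativeRing = record { isCommutativeRing = isCommutativeRing }

  open CommutativeRing commutativeRing public
    using (ring; +-identityʳ; *-identityʳ; zeroˡ; zeroʳ; -‿inverseˡ)
  open Algebra.Properties.Ring ring public
    using (-‿involutive; -‿+-comm; -‿distribˡ-*; -‿distribʳ-*)

  -- Integer coefficients for the ring solver: equality in 𝔽 does not compute
  -- for a variable p, and the numeral # n is fromℤ (+ n) by definition.
  fromℤ : ℤ → 𝔽
  fromℤ (+ n)    = # n
  fromℤ -[1+ n ] = - # (ℕ.suc n)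

  #0-neg : - # 0 ≡ # 0
  #0-neg = trans (sym (+-identityˡ (- # 0))) (-‿inverseʳ (# 0))

  fromℤ-neg : ∀ i → fromℤ (ℤ.- i) ≡ - fromℤ i
  fromℤ-neg (+ ℕ.zero)  = sym #0-neg
  fromℤ-neg (+ ℕ.suc n) = refl
  fromℤ-neg -[1+ n ]    = sym (-‿involutive _)

  #-∸ : ∀ {m n} → n ≤ m → # (m ℕ.∸ n) ≡ # m - # n
  #-∸ {m} {n} n≤m = begin
    # k                ≡⟨ +-identityʳ (# k) ⟨
    # k + # 0          ≡⟨ cong (λ x → # k + x) (-‿inverseʳ (# n)) ⟨
    # k + (# n - # n)  ≡⟨ +-assoc (# k) (# n) (- # n) ⟨
    # k + # n - # n    ≡⟨ cong (_- # n) (#-+ k n) ⟨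
    # (k ℕ.+ n) - # n  ≡⟨ cong (λ l → # l - # n) (ℕ.m∸n+n≡m n≤m) ⟩
    # m - # n          ∎
    where k = m ℕ.∸ n

  fromℤ-⊖ : ∀ m n → fromℤ (m ℤ.⊖ n) ≡ # m - # n
  fromℤ-⊖ m n with n ℕ.≤? m
  ... | yes n≤m = trans (cong fromℤ (ℤ.⊖-≥ n≤m)) (#-∸ n≤m)
  ... | no  n≰m = begin
    fromℤ (m ℤ.⊖ n)              ≡⟨ cong fromℤ (ℤ.⊖-< (ℕ.≰⇒> n≰m)) ⟩
    fromℤ (ℤ.- + (n ℕ.∸ m))      ≡⟨ fromℤ-neg (+ (n ℕ.∸ m)) ⟩
    - # (n ℕ.∸ m)                ≡⟨ cong (λ x → - x) (#-∸ (ℕ.<⇒≤ (ℕ.≰⇒> n≰m))) ⟩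
    - (# n - # m)                ≡⟨ -‿+-comm (# n) (- # m) ⟨
    - # n + - - # m              ≡⟨ cong (λ x → - # n + x) (-‿involutive (# m)) ⟩
    - # n + # m                  ≡⟨ +-comm (- # n) (# m) ⟩
    # m - # n                    ∎

  fromℤ-+ : ∀ i j → fromℤ (i ℤ.+ j) ≡ fromℤ i + fromℤ j
  fromℤ-+ (+ m)    (+ n)    = #-+ m n
  fromℤ-+ (+ m)    -[1+ n ] = fromℤ-⊖ m (ℕ.suc n)
  fromℤ-+ -[1+ m ] (+ n)    = trans (fromℤ-⊖ n (ℕ.suc m)) (+-comm (# n) _)
  fromℤ-+ -[1+ m ] -[1+ n ] = begin
    - # (ℕ.suc (ℕ.suc (m ℕ.+ n)))        ≡⟨ cong (λ x → - # ℕ.suc x) (ℕ.+-suc m n) ⟨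
    - # (ℕ.suc m ℕ.+ ℕ.suc n)            ≡⟨ cong (λ x → - x) (#-+ (ℕ.suc m) (ℕ.suc n)) ⟩
    - (# ℕ.suc m + # ℕ.suc n)            ≡⟨ -‿+-comm (# ℕ.suc m) (# ℕ.suc n) ⟨
    - # ℕ.suc m - # ℕ.suc n              ∎

  fromℤ-*ʳ : ∀ m j → fromℤ (+ m ℤ.* j) ≡ # m * fromℤ j
  fromℤ-*ʳ m (+ n)    = trans (cong fromℤ (sym (ℤ.pos-* m n))) (#-* m n)
  fromℤ-*ʳ m -[1+ n ] = begin
    fromℤ (+ m ℤ.* (ℤ.- + ℕ.suc n))   ≡⟨ cong fromℤ (ℤ.neg-distribʳ-* (+ m) (+ ℕ.suc n)) ⟨
    fromℤ (ℤ.- (+ m ℤ.* + ℕ.suc n))   ≡⟨ fromℤ-neg (+ m ℤ.* + ℕ.suc n) ⟩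
    - fromℤ (+ m ℤ.* + ℕ.suc n)       ≡⟨ cong (λ x → - x) (fromℤ-*ʳ m (+ ℕ.suc n)) ⟩
    - (# m * # ℕ.suc n)               ≡⟨ -‿distribʳ-* (# m) (# ℕ.suc n) ⟩
    # m * - # ℕ.suc n                 ∎

  fromℤ-* : ∀ i j → fromℤ (i ℤ.* j) ≡ fromℤ i * fromℤ j
  fromℤ-* (+ m)    j = fromℤ-*ʳ m j
  fromℤ-* -[1+ m ] j = begin
    fromℤ ((ℤ.- + ℕ.suc m) ℤ.* j)     ≡⟨ cong fromℤ (ℤ.neg-distribˡ-* (+ ℕ.suc m) j) ⟨
    fromℤ (ℤ.- (+ ℕ.suc m ℤ.* j))     ≡⟨ fromℤ-neg (+ ℕ.suc m ℤ.* j) ⟩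
    - fromℤ (+ ℕ.suc m ℤ.* j)         ≡⟨ cong (λ x → - x) (fromℤ-*ʳ (ℕ.suc m) j) ⟩
    - (# ℕ.suc m * fromℤ j)           ≡⟨ -‿distribˡ-* (# ℕ.suc m) (fromℤ j) ⟩
    - # ℕ.suc m * fromℤ j             ∎

  fromℤ-morphism : ℤ.+-*-rawRing -Raw-AlmostCommutative⟶ fromCommutativeRing commutativeRing
  fromℤ-morphism = record
    { ⟦_⟧ = fromℤ ; +-homo = fromℤ-+ ; *-homo = fromℤ-* ; -‿homo = fromℤ-neg
    ; 0-homo = refl ; 1-homo = refl
    }

  open Algebra.Solver.Ring ℤ.+-*-rawRing (fromCommutativeRing commutativeRing)
    fromℤ-morphism (λ i j → Maybe.map (cong fromℤ) (dec⇒maybe (i ℤ.≟ j))) public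
    using (Polynomial; solve; _:=_; _:+_; _:-_; _:*_; :-_)
    renaming (con to :con)

-- Inverses in the residue field of an odd prime

module OddPrimeField (p : ℕ) .{{_ : NonZero p}} (p-prime : Prime p) (2<p : 2 < p) where
  open ResidueField p
  open ResidueRing p
  open ≡-Reasoning

  inverse : ∀ {a} → a ≢ # 0 → ∃ λ b → a * b ≡ # 1
  inverse {a} a≢0 with coprime-Bézout (prime⇒coprime p-prime {{ℕ.≢-nonZero toℕa≢0}} (toℕ<n a))
    where
    toℕa≢0 : toℕ a ≢ 0
    toℕa≢0 eq = a≢0 (trans (sym (#-toℕ a)) (cong #_ eq))
  -- Bézout over ℕ has no subtraction and so comes in two forms. Here 1 + y a = x p, which makes -y
  -- the inverse; the other form gives y itself.
  ... | +- x y eq = - # y , (begin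
    a * - # y                               ≡⟨ solve 2 (λ a y → a :* (:- y) := :con (+ 1) :- (:con (+ 1) :+ y :* a)) refl a (# y) ⟩
    # 1 - (# 1 + # y * a)                   ≡⟨ cong (λ c → # 1 - (# 1 + # y * c)) (#-toℕ a) ⟨
    # 1 - (# 1 + # y * # toℕ a)             ≡⟨ cong (λ c → # 1 - (# 1 + c)) (#-* y (toℕ a)) ⟨
    # 1 - (# 1 + # (y ℕ.* toℕ a))           ≡⟨ cong (λ c → # 1 - c) (#-+ 1 (y ℕ.* toℕ a)) ⟨
    # 1 - # (1 ℕ.+ y ℕ.* toℕ a)             ≡⟨ cong (λ k → # 1 - # k) eq ⟩
    # 1 - # (x ℕ.* p)                       ≡⟨ cong (λ c → # 1 - c) (#-* x p) ⟩
    # 1 - # x * # p                         ≡⟨ cong (λ c → # 1 - # x * c) #p≡#0 ⟩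
    # 1 - # x * # 0                         ≡⟨ solve 1 (λ x → :con (+ 1) :- x :* :con (+ 0) := :con (+ 1)) refl (# x) ⟩
    # 1                                     ∎)
  ... | -+ x y eq = # y , (begin
    a * # y                     ≡⟨ *-comm a (# y) ⟩
    # y * a                     ≡⟨ cong (λ c → # y * c) (#-toℕ a) ⟨
    # y * # toℕ a               ≡⟨ #-* y (toℕ a) ⟨
    # (y ℕ.* toℕ a)             ≡⟨ cong #_ eq ⟨
    # (1 ℕ.+ x ℕ.* p)           ≡⟨ #-+ 1 (x ℕ.* p) ⟩
    # 1 + # (x ℕ.* p)           ≡⟨ cong (λ c → # 1 + c) (#-* x p) ⟩
    # 1 + # x * # p             ≡⟨ cong (λ c → # 1 + # x * c) #p≡#0 ⟩
    # 1 + # x * # 0             ≡⟨ solve 1 (λ x → :con (+ 1) :+ x :* :con (+ 0) := :con (+ 1)) refl (# x) ⟩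
    # 1                         ∎)

  *-⁻¹ : ∀ {a} → a ≢ # 0 → a * a ⁻¹ ≡ # 1
  *-⁻¹ {a} a≢0 with any? (λ b → a * b ≟ # 1)
  ... | yes (_ , eq) = eq
  ... | no  ∄        = contradiction (inverse a≢0) ∄

  *-/-cancel : ∀ {c} → c ≢ # 0 → ∀ d → c * (d / c) ≡ d
  *-/-cancel {c} c≢0 d = begin
    c * (d * c ⁻¹)  ≡⟨ solve 3 (λ c d i → c :* (d :* i) := d :* (c :* i)) refl c d (c ⁻¹) ⟩
    d * (c * c ⁻¹)  ≡⟨ cong (d *_) (*-⁻¹ c≢0) ⟩
    d * # 1         ≡⟨ *-identityʳ d ⟩
    d               ∎

  small≢0 : ∀ {n} → .{{NonZero n}} → n < p → # n ≢ # 0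
  small≢0 {ℕ.suc n} n<p eq = contradiction (begin
    ℕ.suc n           ≡⟨ m<n⇒m%n≡m n<p ⟨
    _                 ≡⟨ toℕ-# (ℕ.suc n) ⟨
    toℕ (# ℕ.suc n)   ≡⟨ cong toℕ eq ⟩
    toℕ (# 0)         ≡⟨ toℕ-# 0 ⟩
    _                 ≡⟨ m<n⇒m%n≡m (ℕ.>-nonZero⁻¹ p) ⟩
    0                 ∎) λ ()

  0⁻¹ : # 0 ⁻¹ ≡ # 0
  0⁻¹ with any? (λ b → # 0 * b ≟ # 1)
  ... | yes (b , eq) = contradiction (trans (sym eq) (zeroˡ b))
                                     (small≢0 (ℕ.<-trans (ℕ.s≤s (ℕ.s≤s ℕ.z≤n)) 2<p))
  ... | no  _        = refl

  *-cancelˡ : ∀ {a b c} → a ≢ # 0 → a * b ≡ a * c → b ≡ c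
  *-cancelˡ {a} {b} {c} a≢0 eq = begin
    b                ≡⟨ unscale b ⟩
    (a * b) * a ⁻¹   ≡⟨ cong (_* a ⁻¹) eq ⟩
    (a * c) * a ⁻¹   ≡⟨ unscale c ⟨
    c                ∎
    where
    unscale : ∀ d → d ≡ (a * d) * a ⁻¹
    unscale d = trans (sym (*-/-cancel a≢0 d)) (sym (*-assoc a d (a ⁻¹)))

  *-zero-factor : ∀ {a b} → a ≢ # 0 → a * b ≡ # 0 → b ≡ # 0
  *-zero-factor {a} a≢0 eq = *-cancelˡ a≢0 (trans eq (sym (zeroʳ a)))

  *-≢0 : ∀ {a b} → a ≢ # 0 → b ≢ # 0 → a * b ≢ # 0
  *-≢0 a≢0 b≢0 eq = b≢0 (*-zero-factor a≢0 eq)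

  -≡0⇒≡ : ∀ {a b} → a - b ≡ # 0 → a ≡ b
  -≡0⇒≡ {a} {b} eq = begin
    a            ≡⟨ solve 2 (λ a b → a := b :+ (a :- b)) refl a b ⟩
    b + (a - b)  ≡⟨ cong (λ c → b + c) eq ⟩
    b + # 0      ≡⟨ +-identityʳ b ⟩
    b            ∎

  ≡⇒-≡0 : ∀ {a b} → a ≡ b → a - b ≡ # 0
  ≡⇒-≡0 {a} refl = -‿inverseʳ a

  -- Total because of the junk value 0⁻¹ = 0.
  ⁻¹-scaled-involutive : ∀ {c} → c ≢ # 0 → ∀ w → c * (c * w ⁻¹) ⁻¹ ≡ w
  ⁻¹-scaled-involutive {c} c≢0 w with w ≟ # 0
  ... | yes refl = begin
    c * (c * # 0 ⁻¹) ⁻¹  ≡⟨ cong (λ i → c * (c * i) ⁻¹) 0⁻¹ ⟩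
    c * (c * # 0) ⁻¹     ≡⟨ cong (λ i → c * i ⁻¹) (zeroʳ c) ⟩
    c * # 0 ⁻¹           ≡⟨ cong (c *_) 0⁻¹ ⟩
    c * # 0              ≡⟨ zeroʳ c ⟩
    # 0                  ∎
  ... | no w≢0 = *-cancelˡ cw⁻¹≢0 (begin
    c * w ⁻¹ * (c * d ⁻¹)   ≡⟨ solve 3 (λ c i j → c :* i :* (c :* j) := c :* ((c :* i) :* j)) refl c (w ⁻¹) (d ⁻¹) ⟩
    c * (d * d ⁻¹)          ≡⟨ cong (c *_) (*-⁻¹ cw⁻¹≢0) ⟩
    c * # 1                 ≡⟨ cong (c *_) (*-⁻¹ w≢0) ⟨
    c * (w * w ⁻¹)          ≡⟨ solve 3 (λ c i w → c :* (w :* i) := c :* i :* w) refl c (w ⁻¹) w ⟩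
    c * w ⁻¹ * w            ∎)
    where
    d = c * w ⁻¹
    1≢0 : # 1 ≢ # 0
    1≢0 = small≢0 (ℕ.<-trans (ℕ.s≤s (ℕ.s≤s ℕ.z≤n)) 2<p)
    cw⁻¹≢0 : d ≢ # 0
    cw⁻¹≢0 = *-≢0 c≢0 λ eq → 1≢0 (trans (sym (*-⁻¹ w≢0)) (trans (cong (w *_) eq) (zeroʳ w)))

  2≢0 : # 2 ≢ # 0
  2≢0 = small≢0 2<p

  -- Under 2 < p the numeral 4 may exceed p, as may 8 below, so `small≢0` does not reach them; they
  -- are nonzero as powers of two.
  4≢0 : # 4 ≢ # 0
  4≢0 = subst (_≢ # 0) (sym (#-* 2 2)) (*-≢0 2≢0 2≢0)

  8≢0 : # 8 ≢ # 0
  8≢0 = subst (_≢ # 0) (sym (#-* 2 4)) (*-≢0 2≢0 4≢0)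

  -- The quadratic character and roots of quadratics

  σ-zero : ∀ {a} → a ≡ # 0 → σ a ≡ 0ℤ
  σ-zero {a} a≡0 with a ≟ # 0
  ... | yes _   = refl
  ... | no a≢0  = contradiction a≡0 a≢0

  σ-square : ∀ {a s} → s ≢ # 0 → a ≡ s * s → σ a ≡ 1ℤ
  σ-square {a} {s} s≢0 a≡s² with a ≟ # 0 | isSquare? a
  ... | yes a≡0 | _      = contradiction (trans (sym a≡s²) a≡0) (*-≢0 s≢0 s≢0)
  ... | no _    | yes _  = refl
  ... | no _    | no ¬sq = contradiction (s , sym a≡s²) ¬sq

  -- The bridge from the character to point counts: the values 0, 1, -1 of σ stand for one, two and
  -- no roots. Odd p enters where r and -r have to differ, as r = -r would give 2r = 0.
  square-roots : ∀ Δ → sum (λ t → ⟦ t * t ≟ Δ ⟧) ≡ 1ℤ ℤ.+ σ Δ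
  square-roots Δ with Δ ≟ # 0 | isSquare? Δ
  ... | yes refl | _ = sum-unique (λ t → t * t ≟ # 0) (# 0) root≡0 (zeroˡ (# 0))
    where
    root≡0 : ∀ t → t * t ≡ # 0 → t ≡ # 0
    root≡0 t eq with t ≟ # 0
    ... | yes t≡0 = t≡0
    ... | no  t≢0 = *-zero-factor t≢0 eq
  ... | no Δ≢0 | yes (r , r²≡Δ) = begin
    sum (λ t → ⟦ t * t ≟ Δ ⟧)
      ≡⟨ sum-cong-≗ (λ t → ⟦⟧-⊎ (t * t ≟ Δ) (t ≟ r) (t ≟ - r) (split t) (λ { refl → r²≡Δ })
                               (λ { refl → trans neg-square r²≡Δ }) λ { (refl , r≡-r) → r≢-r r≡-r }) ⟩
    sum (λ t → ⟦ t ≟ r ⟧ ℤ.+ ⟦ t ≟ - r ⟧)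
      ≡⟨ ∑-distrib-+ (λ t → ⟦ t ≟ r ⟧) (λ t → ⟦ t ≟ - r ⟧) ⟩
    sum (λ t → ⟦ t ≟ r ⟧) ℤ.+ sum (λ t → ⟦ t ≟ - r ⟧)
      ≡⟨ cong₂ ℤ._+_ (sum-δ r) (sum-δ (- r)) ⟩
    + 2 ∎
    where
    neg-square : - r * - r ≡ r * r
    neg-square = solve 1 (λ r → (:- r) :* (:- r) := r :* r) refl r
    r≢0 : r ≢ # 0
    r≢0 r≡0 = Δ≢0 (trans (sym r²≡Δ) (trans (cong (_* r) r≡0) (zeroˡ r)))
    r≢-r : r ≢ - r
    r≢-r eq = *-≢0 2≢0 r≢0 (trans (solve 1 (λ r → :con (+ 2) :* r := r :- (:- r)) refl r) (≡⇒-≡0 eq))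
    split : ∀ t → t * t ≡ Δ → t ≡ r ⊎ t ≡ - r
    split t t²≡Δ with t ≟ r
    ... | yes t≡r = inj₁ t≡r
    ... | no  t≢r = inj₂ (-≡0⇒≡ (*-zero-factor (t≢r ∘ -≡0⇒≡) (begin
      (t - r) * (t - - r)  ≡⟨ solve 2 (λ t r → (t :- r) :* (t :- (:- r)) := t :* t :- r :* r) refl t r ⟩
      t * t - r * r        ≡⟨ ≡⇒-≡0 (trans t²≡Δ (sym r²≡Δ)) ⟩
      # 0                  ∎)))
  ... | no Δ≢0 | no ¬square = sum-none (λ t → t * t ≟ Δ) λ t t²≡Δ → ¬square (t , t²≡Δ)

  -- The affine map y ↦ (s y + r) / m permutes 𝔽 and carries the equation to t² = Δ. The factor m²
  -- is there because completing the square in a fibre produces 16 times the cubic.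
  quadratic-roots : ∀ {s m} → s ≢ # 0 → m ≢ # 0 → ∀ r Δ →
    sum (λ y → ⟦ (s * y + r) * (s * y + r) ≟ m * m * Δ ⟧) ≡ 1ℤ ℤ.+ σ Δ
  quadratic-roots {s} {m} s≢0 m≢0 r Δ = begin
    sum (λ y → ⟦ (s * y + r) * (s * y + r) ≟ m * m * Δ ⟧)
      ≡⟨ sum-cong-≗ (λ y → ⟦⟧-cong ((s * y + r) * (s * y + r) ≟ m * m * Δ) (to y * to y ≟ Δ)
           (λ eq → *-cancelˡ (*-≢0 m≢0 m≢0) (trans (sym (scale y)) eq))
           (λ eq → trans (scale y) (cong (m * m *_) eq))) ⟩
    sum (λ y → ⟦ to y * to y ≟ Δ ⟧)
      ≡⟨ sum-bijection (λ t → ⟦ t * t ≟ Δ ⟧) to from to-from from-to ⟨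
    sum (λ t → ⟦ t * t ≟ Δ ⟧)
      ≡⟨ square-roots Δ ⟩
    1ℤ ℤ.+ σ Δ ∎
    where
    to from : 𝔽 → 𝔽
    to y   = (s * y + r) * m ⁻¹
    from t = (m * t - r) * s ⁻¹
    scale : ∀ y → (s * y + r) * (s * y + r) ≡ m * m * (to y * to y)
    scale y = begin
      (s * y + r) * (s * y + r)      ≡⟨ cong (λ c → c * c) (*-/-cancel m≢0 (s * y + r)) ⟨
      (m * to y) * (m * to y)        ≡⟨ solve 2 (λ m t → (m :* t) :* (m :* t) := m :* m :* (t :* t)) refl m (to y) ⟩
      m * m * (to y * to y)          ∎
    to-from : ∀ t → to (from t) ≡ t
    to-from t = *-cancelˡ m≢0 (begin
      m * to (from t)        ≡⟨ *-/-cancel m≢0 (s * from t + r) ⟩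
      s * from t + r         ≡⟨ cong (_+ r) (*-/-cancel s≢0 (m * t - r)) ⟩
      m * t - r + r          ≡⟨ solve 2 (λ a r → a :- r :+ r := a) refl (m * t) r ⟩
      m * t                  ∎)
    from-to : ∀ y → from (to y) ≡ y
    from-to y = *-cancelˡ s≢0 (begin
      s * from (to y)        ≡⟨ *-/-cancel s≢0 (m * to y - r) ⟩
      m * to y - r           ≡⟨ cong (_- r) (*-/-cancel m≢0 (s * y + r)) ⟩
      s * y + r - r          ≡⟨ solve 2 (λ a r → a :+ r :- r := a) refl (s * y) r ⟩
      s * y                  ∎)

-- The z-discriminant of f and its zeros

module DiscriminantCurve (p : ℕ) .{{_ : NonZero p}} (p-prime : Prime p) (2<p : 2 < p) where
  open ResidueField p
  open ResidueRing p
  open OddPrimeField p p-prime 2<p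
  open ≡-Reasoning

  -- For E = D - D• this is the discriminant of f as a quadratic in z.
  K : 𝔽 → 𝔽 → 𝔽 → 𝔽 → 𝔽
  K C E x y = (x + # 2) * (y + # 2) * ((x - # 2) * (y - # 2) - # 2 * C) + # 4 * E

  :K : ∀ {n} → (C E x y : Polynomial n) → Polynomial n
  :K C E x y = (x :+ :con (+ 2)) :* (y :+ :con (+ 2)) :* ((x :- :con (+ 2)) :* (y :- :con (+ 2)) :- :con (+ 2) :* C) :+ :con (+ 4) :* E

  -- With d in place of D• C, so that the division by 4 only enters through 4 D•.
  discriminant-identity : ∀ C D d x y z →
    # 4 * eval (f C D) (x ∷ y ∷ z ∷ []) ≡
    (# 2 * z - (x * y - C)) * (# 2 * z - (x * y - C)) - K C (D - d) x y
      + (# 16 - # 8 * C - C * C - # 4 * d)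
  discriminant-identity = solve 6 (λ C D d x y z →
    :con (+ 4) :* (x :* x :+ y :* y :+ z :* z :- x :* y :* z :+ C :* (x :+ y :+ z) :- D) :=
    (:con (+ 2) :* z :- (x :* y :- C)) :* (:con (+ 2) :* z :- (x :* y :- C)) :- :K C (D :- d) x y
      :+ (:con (+ 16) :- :con (+ 8) :* C :- C :* C :- :con (+ 4) :* d)) refl

  ∂z-f : ∀ C D x y z →
    eval (∂ (suc (suc zero)) (f C D)) (x ∷ y ∷ z ∷ []) ≡ # 2 * z - (x * y - C)
  ∂z-f C D = solve 4 (λ C x y z →
    -- The left side repeats the unsimplified Leibniz expansion produced by `∂`, with `o` and `e` as
    -- the derivatives 0 and 1 of constants and variables, so that it unfolds to the same term.
    let o = :con (+ 0) ; e = :con (+ 1) in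
    (o :* x :+ x :* o) :+ (o :* y :+ y :* o) :+ (e :* z :+ z :* e)
      :- ((o :* y :+ x :* o) :* z :+ (x :* y) :* e)
      :+ (o :* (x :+ y :+ z) :+ C :* (o :+ o :+ e)) :- o :=
    :con (+ 2) :* z :- (x :* y :- C)) refl C

  4*D• : ∀ C → # 16 - # 8 * C - C * C - # 4 * D• C ≡ # 0
  4*D• C = begin
    # 16 - # 8 * C - C * C - # 4 * D• C
      -- With q standing for the inverse of 4, everything cancels except C²(4q - 1).
      ≡⟨ solve 2 (λ C q →
           :con (+ 16) :- :con (+ 8) :* C :- C :* C
             :- :con (+ 4) :* (:con (+ 4) :- :con (+ 2) :* C :- (C :* (C :* :con (+ 1))) :* q) :=
           C :* C :* (:con (+ 4) :* q :- :con (+ 1))) refl C (# 4 ⁻¹) ⟩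
    C * C * (# 4 * # 4 ⁻¹ - # 1)  ≡⟨ cong (C * C *_) (≡⇒-≡0 (*-⁻¹ 4≢0)) ⟩
    C * C * # 0                   ≡⟨ zeroʳ (C * C) ⟩
    # 0                           ∎

  -- The factor 4 completes the square in z, and w is the z-derivative of f. Where it vanishes, f =
  -- 0 turns into K = 0, since 4 is invertible.
  4*f : ∀ C D x y z → let w = # 2 * z - (x * y - C) in
    # 4 * eval (f C D) (x ∷ y ∷ z ∷ []) ≡ w * w - K C (D - D• C) x y
  4*f C D x y z = begin
    # 4 * eval (f C D) (x ∷ y ∷ z ∷ [])                ≡⟨ discriminant-identity C D (D• C) x y z ⟩
    k + (# 16 - # 8 * C - C * C - # 4 * D• C)          ≡⟨ cong (λ c → k + c) (4*D• C) ⟩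
    k + # 0                                            ≡⟨ +-identityʳ k ⟩
    k                                                  ∎
    where
    w = # 2 * z - (x * y - C)
    k = w * w - K C (D - D• C) x y

  count-z : ∀ C D x y →
    sum (λ z → ⟦ criticalZero? (f C D) (x , y , z) ⟧) ≡ ⟦ K C (D - D• C) x y ≟ # 0 ⟧
  count-z C D x y = by-cases (k ≟ # 0)
    where
    k = K C (D - D• C) x y
    z₀ = (x * y - C) / # 2
    2z₀ : # 2 * z₀ ≡ x * y - C
    2z₀ = *-/-cancel 2≢0 (x * y - C)
    unique : ∀ z → CriticalZero (f C D) (x , y , z) → z ≡ z₀
    unique z (_ , ∂f≡0) = *-cancelˡ 2≢0
      (trans (-≡0⇒≡ (trans (sym (∂z-f C D x y z)) ∂f≡0)) (sym 2z₀))
    critical⇒K≡0 : ∀ z → CriticalZero (f C D) (x , y , z) → k ≡ # 0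
    critical⇒K≡0 z (f≡0 , ∂f≡0) = sym (-≡0⇒≡ (begin
      # 0 - k        ≡⟨ cong (_- k) (zeroˡ (# 0)) ⟨
      # 0 * # 0 - k  ≡⟨ cong (λ c → c * c - k) (trans (sym (∂z-f C D x y z)) ∂f≡0) ⟨
      w * w - k      ≡⟨ 4*f C D x y z ⟨
      # 4 * eval (f C D) (x ∷ y ∷ z ∷ [])  ≡⟨ cong (# 4 *_) f≡0 ⟩
      # 4 * # 0      ≡⟨ zeroʳ (# 4) ⟩
      # 0            ∎))
      where w = # 2 * z - (x * y - C)
    K≡0⇒critical : k ≡ # 0 → CriticalZero (f C D) (x , y , z₀)
    K≡0⇒critical k≡0 = *-zero-factor 4≢0 (begin
      # 4 * eval (f C D) (x ∷ y ∷ z₀ ∷ [])  ≡⟨ 4*f C D x y z₀ ⟩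
      w * w - k                             ≡⟨ cong₂ (λ c d → c * c - d) (≡⇒-≡0 2z₀) k≡0 ⟩
      # 0 * # 0 - # 0                       ≡⟨ ≡⇒-≡0 (zeroˡ (# 0)) ⟩
      # 0                                   ∎) , trans (∂z-f C D x y z₀) (≡⇒-≡0 2z₀)
      where w = # 2 * z₀ - (x * y - C)
    -- Abstracting the decision lets `⟦ d ⟧` reduce to 1 or 0 in each clause.
    by-cases : (d : Dec (k ≡ # 0)) → sum (λ z → ⟦ criticalZero? (f C D) (x , y , z) ⟧) ≡ ⟦ d ⟧
    by-cases (yes k≡0) = sum-unique (λ z → criticalZero? (f C D) (x , y , z)) z₀ unique (K≡0⇒critical k≡0)
    by-cases (no k≢0)  = sum-none (λ z → criticalZero? (f C D) (x , y , z)) λ z crit → k≢0 (critical⇒K≡0 z crit)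

  count-y : 𝔽 → 𝔽 → 𝔽 → ℤ
  count-y C E x = sum (λ y → ⟦ K C E x y ≟ # 0 ⟧)

  N₁-as-sum : ∀ C D → + N₁ (f C D) ≡ sum (count-y C (D - D• C))
  N₁-as-sum C D = begin
    + N₁ (f C D)
      ≡⟨ length-filter-cartesianProduct critical? (λ i → i) 𝔽² ⟩
    sum (λ x → + length (filter (λ yz → critical? (x , yz)) 𝔽²))
      ≡⟨ sum-cong-≗ (λ x → length-filter-cartesianProduct (λ yz → critical? (x , yz)) (λ i → i) (allFin p)) ⟩
    sum (λ x → sum λ y → + length (filter (λ z → critical? (x , y , z)) (allFin p)))
      ≡⟨ sum-cong-≗ (λ x → sum-cong-≗ λ y → trans
           (length-filter-tabulate (λ z → critical? (x , y , z)) (λ i → i)) (count-z C D x y)) ⟩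
    sum (count-y C (D - D• C)) ∎
    where
    critical? = criticalZero? (f C D)
    𝔽² = cartesianProduct (allFin p) (allFin p)

  -- At b = (C - 8)/2 and E = D - D• this unfolds to `cubic C D w`. With b and E as free parameters
  -- it contains no division and is accessible to the ring solver.
  Λ : 𝔽 → 𝔽 → 𝔽 → 𝔽
  Λ b E w = w ^ 3 - E * w ^ 2 + (b * w + # 4 * E) ^ 2

  -- The trailing unit `e` mirrors how `_^_` computes: `w ^ 2` unfolds to `w * (w * # 1)`, and the
  -- solver term has to unfold to `Λ` itself.
  :Λ : ∀ {n} → (b E w : Polynomial n) → Polynomial n
  :Λ b E w = w :* (w :* (w :* e)) :- E :* (w :* (w :* e)) :+ s :* (s :* e)
    where s = b :* w :+ :con (+ 4) :* E ; e = :con (+ 1)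

  -- For u = x + 2 ≠ 0 the equation K = 0 is quadratic in y; completing the
  -- square and putting w = 4 E / u turns its discriminant into the cubic.  Here
  -- w = 4 v and E = u v.
  complete-square : ∀ {C E x w u v} b y →
    x ≡ u - # 2 → w ≡ # 4 * v → E ≡ u * v → C ≡ # 2 * b + # 8 →
    let a = u - # 4 ; t = # 2 * a * w * y + - (# 2 * C * w) in
    u * (t * t - # 4 * # 4 * Λ b E w) ≡ # 4 * a * w * w * K C E x y
  complete-square {u = u} {v} b y refl refl refl refl = solve 4 (λ u v b y →
    let a = u :- :con (+ 4) ; w = :con (+ 4) :* v ; E = u :* v ; C = :con (+ 2) :* b :+ :con (+ 8)
        t = :con (+ 2) :* a :* w :* y :+ (:- (:con (+ 2) :* C :* w)) in
    u :* (t :* t :- :con (+ 4) :* :con (+ 4) :* :Λ b E w) :=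
    :con (+ 4) :* a :* w :* w :* :K C E (u :- :con (+ 2)) y) refl u v b y

  -- The case E ≠ 0: fibres and values of the cubic

  module Smooth (C E : 𝔽) (E≢0 : E ≢ # 0) where

    b : 𝔽
    b = (C - # 8) / # 2

    4*E≢0 : # 4 * E ≢ # 0
    4*E≢0 = *-≢0 4≢0 E≢0

    C≡2b+8 : C ≡ # 2 * b + # 8
    C≡2b+8 = begin
      C                ≡⟨ solve 2 (λ C e → C := C :- e :+ e) refl C (# 8) ⟩
      C - # 8 + # 8    ≡⟨ cong (_+ # 8) (*-/-cancel 2≢0 (C - # 8)) ⟨
      # 2 * b + # 8    ∎

    count-y-generic : ∀ {u w} → u * w ≡ # 4 * E → u - # 4 ≢ # 0 →
                      count-y C E (u - # 2) ≡ 1ℤ ℤ.+ σ (Λ b E w)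
    count-y-generic {u} {w} uw≡4E a≢0 = begin
      count-y C E (u - # 2)
        -- The identity relates k K to u (t² - 16 λ(w)) with k and u both nonzero, so the two
        -- equations in y are equivalent.
        ≡⟨ sum-cong-≗ (λ y → ⟦⟧-cong (K C E (u - # 2) y ≟ # 0) (t y * t y ≟ # 4 * # 4 * Λ b E w)
             (λ K≡0 → -≡0⇒≡ (*-zero-factor u≢0
               (trans (identity y) (trans (cong (k *_) K≡0) (zeroʳ k)))))
             (λ eq → *-zero-factor k≢0
               (trans (sym (identity y)) (trans (cong (u *_) (≡⇒-≡0 eq)) (zeroʳ u))))) ⟩
      sum (λ y → ⟦ t y * t y ≟ # 4 * # 4 * Λ b E w ⟧)
        ≡⟨ quadratic-roots (*-≢0 (*-≢0 2≢0 a≢0) w≢0) 4≢0 (- (# 2 * C * w)) (Λ b E w) ⟩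
      1ℤ ℤ.+ σ (Λ b E w) ∎
      where
      a = u - # 4
      k = # 4 * a * w * w
      -- Then u v = E and w = 4v, the substitution that makes `complete-square` a polynomial
      -- identity free of inverses.
      v = w / # 4
      t : 𝔽 → 𝔽
      t y = # 2 * a * w * y + - (# 2 * C * w)
      u≢0 : u ≢ # 0
      u≢0 u≡0 = 4*E≢0 (trans (sym uw≡4E) (trans (cong (_* w) u≡0) (zeroˡ w)))
      w≢0 : w ≢ # 0
      w≢0 w≡0 = 4*E≢0 (trans (sym uw≡4E) (trans (cong (u *_) w≡0) (zeroʳ u)))
      k≢0 : k ≢ # 0
      k≢0 = *-≢0 (*-≢0 (*-≢0 4≢0 a≢0) w≢0) w≢0
      w≡4v : w ≡ # 4 * v
      w≡4v = sym (*-/-cancel 4≢0 w)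
      E≡uv : E ≡ u * v
      E≡uv = *-cancelˡ 4≢0 (begin
        # 4 * E        ≡⟨ uw≡4E ⟨
        u * w          ≡⟨ cong (u *_) w≡4v ⟩
        u * (# 4 * v)  ≡⟨ solve 3 (λ u q v → u :* (q :* v) := q :* (u :* v)) refl u (# 4) v ⟩
        # 4 * (u * v)  ∎)
      identity : ∀ y → u * (t y * t y - # 4 * # 4 * Λ b E w) ≡ k * K C E (u - # 2) y
      identity y = complete-square b y refl w≡4v E≡uv C≡2b+8

    K-linear : ∀ y → K C E (# 4 - # 2) y ≡ # 4 * (E - # 2 * C * (y + # 2))
    K-linear y = solve 3 (λ C E y → :K C E (:con (+ 4) :- :con (+ 2)) y :=
      :con (+ 4) :* (E :- :con (+ 2) :* C :* (y :+ :con (+ 2)))) refl C E y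

    -- λ(E) = (E(b + 4))² and 2(b + 4) = C. So for C = 0 the character vanishes just when the linear
    -- equation degenerates to 4E = 0 and loses its root.
    count-y-linear-C≡0 : C ≡ # 0 → count-y C E (# 4 - # 2) ≡ σ (Λ b E E)
    count-y-linear-C≡0 C≡0 = trans
      (sum-none (λ y → K C E (# 4 - # 2) y ≟ # 0) λ y K≡0 → 4*E≢0 (begin
        # 4 * E                            ≡⟨ solve 2 (λ E y → :con (+ 4) :* E := :con (+ 4) :* (E :- :con (+ 2) :* :con (+ 0) :* (y :+ :con (+ 2)))) refl E y ⟩
        # 4 * (E - # 2 * # 0 * (y + # 2))  ≡⟨ cong (λ c → # 4 * (E - # 2 * c * (y + # 2))) C≡0 ⟨
        # 4 * (E - # 2 * C * (y + # 2))    ≡⟨ K-linear y ⟨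
        K C E (# 4 - # 2) y                ≡⟨ K≡0 ⟩
        # 0                                ∎))
      (sym (σ-zero (*-cancelˡ 4≢0 (begin
        # 4 * Λ b E E
          ≡⟨ solve 2 (λ b E → :con (+ 4) :* :Λ b E E :=
               (E :* (:con (+ 2) :* b :+ :con (+ 8))) :* (E :* (:con (+ 2) :* b :+ :con (+ 8)))) refl b E ⟩
        (E * (# 2 * b + # 8)) * (E * (# 2 * b + # 8))
          ≡⟨ cong (λ c → (E * c) * (E * c)) (trans (sym C≡2b+8) C≡0) ⟩
        (E * # 0) * (E * # 0)
          ≡⟨ solve 1 (λ E → (E :* :con (+ 0)) :* (E :* :con (+ 0)) := :con (+ 4) :* :con (+ 0)) refl E ⟩
        # 4 * # 0 ∎))))

    -- Here the linear equation has slope -8C ≠ 0, hence one root, matching the value 1 of σ at the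
    -- nonzero square λ(E) = (E(b + 4))².
    count-y-linear-C≢0 : C ≢ # 0 → count-y C E (# 4 - # 2) ≡ σ (Λ b E E)
    count-y-linear-C≢0 C≢0 = trans
      (sum-unique (λ y → K C E (# 4 - # 2) y ≟ # 0) y₀ unique root)
      (sym (σ-square (*-≢0 E≢0 b+4≢0)
        (solve 2 (λ b E → :Λ b E E := (E :* (b :+ :con (+ 4))) :* (E :* (b :+ :con (+ 4)))) refl b E)))
      where
      y₀ = E / (# 2 * C) - # 2
      b+4≢0 : b + # 4 ≢ # 0
      b+4≢0 eq = C≢0 (begin
        C                ≡⟨ C≡2b+8 ⟩
        # 2 * b + # 8    ≡⟨ solve 1 (λ b → :con (+ 2) :* b :+ :con (+ 8) := :con (+ 2) :* (b :+ :con (+ 4))) refl b ⟩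
        # 2 * (b + # 4)  ≡⟨ cong (# 2 *_) eq ⟩
        # 2 * # 0        ≡⟨ zeroʳ (# 2) ⟩
        # 0              ∎)
      2C[y₀+2]≡E : # 2 * C * (y₀ + # 2) ≡ E
      2C[y₀+2]≡E = begin
        # 2 * C * (q - # 2 + # 2)  ≡⟨ solve 2 (λ c q → c :* (q :- :con (+ 2) :+ :con (+ 2)) := c :* q) refl (# 2 * C) q ⟩
        # 2 * C * q                ≡⟨ *-/-cancel (*-≢0 2≢0 C≢0) E ⟩
        E                          ∎
        where q = E / (# 2 * C)
      unique : ∀ y → K C E (# 4 - # 2) y ≡ # 0 → y ≡ y₀
      unique y K≡0 = begin
        y                ≡⟨ solve 1 (λ y → y := y :+ :con (+ 2) :- :con (+ 2)) refl y ⟩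
        y + # 2 - # 2    ≡⟨ cong (_- # 2) (*-cancelˡ (*-≢0 2≢0 C≢0) (trans
                              (sym (-≡0⇒≡ (*-zero-factor 4≢0 (trans (sym (K-linear y)) K≡0)))) (sym 2C[y₀+2]≡E))) ⟩
        y₀ + # 2 - # 2 ≡⟨ solve 1 (λ y → y :+ :con (+ 2) :- :con (+ 2) := y) refl y₀ ⟩
        y₀      ∎
      root : K C E (# 4 - # 2) y₀ ≡ # 0
      root = begin
        K C E (# 4 - # 2) y₀             ≡⟨ K-linear y₀ ⟩
        # 4 * (E - # 2 * C * (y₀ + # 2))   ≡⟨ cong (# 4 *_) (≡⇒-≡0 (sym 2C[y₀+2]≡E)) ⟩
        # 4 * # 0                                   ≡⟨ zeroʳ (# 4) ⟩
        # 0                                         ∎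

    count-y-linear : ∀ {u} → u ≡ # 4 → count-y C E (u - # 2) ≡ σ (Λ b E E)
    count-y-linear refl = by-cases (C ≟ # 0)
      where
      by-cases : Dec (C ≡ # 0) → count-y C E (# 4 - # 2) ≡ σ (Λ b E E)
      by-cases (yes C≡0) = count-y-linear-C≡0 C≡0
      by-cases (no C≢0)  = count-y-linear-C≢0 C≢0

    count-y-empty : ∀ {u} → u ≡ # 0 → count-y C E (u - # 2) ≡ 0ℤ
    count-y-empty refl = sum-none (λ y → K C E (# 0 - # 2) y ≟ # 0) λ y K≡0 → 4*E≢0 (trans
      (solve 3 (λ C E y → :con (+ 4) :* E := :K C E (:con (+ 0) :- :con (+ 2)) y) refl C E y) K≡0)

    -- An involution: the same formula leads from u to w and back. It sends w = 0 and w = E to 0 and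
    -- 4, the two exceptional values of u.
    u : 𝔽 → 𝔽
    u w = # 4 * E * w ⁻¹

    -- The decisions are arguments, here and below, because with-abstraction
    -- would normalise the sum over the fibre.
    count-y-via-σ : ∀ w (d₀ : Dec (w ≡ # 0)) (d₁ : Dec (w ≡ E)) → count-y C E (u w - # 2) ≡
      1ℤ ℤ.+ σ (Λ b E w) ℤ.+ (ℤ.- + 2 ℤ.* ⟦ d₀ ⟧ ℤ.+ ℤ.- 1ℤ ℤ.* ⟦ d₁ ⟧)
    count-y-via-σ w (yes refl) (yes 0≡E) = contradiction (sym 0≡E) E≢0
    count-y-via-σ w (yes refl) (no _) = begin
      count-y C E (u (# 0) - # 2)
        ≡⟨ count-y-empty (trans (cong (# 4 * E *_) 0⁻¹) (zeroʳ (# 4 * E))) ⟩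
      0ℤ
        ≡⟨ cong (λ s → 1ℤ ℤ.+ s ℤ.+ (ℤ.- + 2 ℤ.* 1ℤ ℤ.+ ℤ.- 1ℤ ℤ.* 0ℤ))
             (σ-square 4*E≢0 (solve 2 (λ b E → :Λ b E (:con (+ 0)) := (:con (+ 4) :* E) :* (:con (+ 4) :* E)) refl b E)) ⟨
      1ℤ ℤ.+ σ (Λ b E (# 0)) ℤ.+ (ℤ.- + 2 ℤ.* 1ℤ ℤ.+ ℤ.- 1ℤ ℤ.* 0ℤ) ∎
    count-y-via-σ w (no _) (yes refl) = begin
      count-y C E (u E - # 2)
        ≡⟨ count-y-linear (begin
             # 4 * E * E ⁻¹    ≡⟨ *-assoc (# 4) E (E ⁻¹) ⟩
             # 4 * (E * E ⁻¹)  ≡⟨ cong (# 4 *_) (*-⁻¹ E≢0) ⟩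
             # 4 * # 1         ≡⟨ *-identityʳ (# 4) ⟩
             # 4               ∎) ⟩
      σ (Λ b E E)
        ≡⟨ solveℤ 1 (λ s → s ≐ conℤ 1ℤ ⊞ s ⊞ conℤ (ℤ.- 1ℤ)) refl (σ (Λ b E E)) ⟩
      1ℤ ℤ.+ σ (Λ b E E) ℤ.+ (ℤ.- + 2 ℤ.* 0ℤ ℤ.+ ℤ.- 1ℤ ℤ.* 1ℤ) ∎
    count-y-via-σ w (no w≢0) (no w≢E) = trans (count-y-generic uw≡4E u-4≢0) (sym (ℤ.+-identityʳ _))
      where
      uw≡4E : u w * w ≡ # 4 * E
      uw≡4E = begin
        # 4 * E * w ⁻¹ * w    ≡⟨ solve 3 (λ c i w → c :* i :* w := c :* (w :* i)) refl (# 4 * E) (w ⁻¹) w ⟩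
        # 4 * E * (w * w ⁻¹)  ≡⟨ cong (# 4 * E *_) (*-⁻¹ w≢0) ⟩
        # 4 * E * # 1         ≡⟨ *-identityʳ (# 4 * E) ⟩
        # 4 * E               ∎
      u-4≢0 : u w - # 4 ≢ # 0
      u-4≢0 eq = w≢E (*-cancelˡ 4≢0 (trans (cong (_* w) (sym (-≡0⇒≡ {u w} {# 4} eq))) uw≡4E))

    sum-count-y : sum (count-y C E) ≡ + p ℤ.- + 3 ℤ.+ sum (λ w → σ (Λ b E w))
    sum-count-y = begin
      sum (count-y C E)
        ≡⟨ sum-bijection (count-y C E) (λ w → u w - # 2) (λ x → u (x + # 2))
             (λ x → trans (cong (_- # 2) (⁻¹-scaled-involutive 4*E≢0 (x + # 2)))
                          (solve 1 (λ x → x :+ :con (+ 2) :- :con (+ 2) := x) refl x))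
             (λ w → trans (cong u (solve 1 (λ x → x :- :con (+ 2) :+ :con (+ 2) := x) refl (u w)))
                          (⁻¹-scaled-involutive 4*E≢0 w)) ⟩
      sum (λ w → count-y C E (u w - # 2))
        ≡⟨ sum-cong-≗ (λ w → count-y-via-σ w (w ≟ # 0) (w ≟ E)) ⟩
      sum (λ w → 1ℤ ℤ.+ s w ℤ.+ (δ₀ w ℤ.+ δE w))
        ≡⟨ ∑-distrib-+ (λ w → 1ℤ ℤ.+ s w) (λ w → δ₀ w ℤ.+ δE w) ⟩
      sum (λ w → 1ℤ ℤ.+ s w) ℤ.+ sum (λ w → δ₀ w ℤ.+ δE w)
        ≡⟨ cong₂ ℤ._+_ (∑-distrib-+ {p} (λ _ → 1ℤ) s) (∑-distrib-+ δ₀ δE) ⟩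
      (sum {p} (λ _ → 1ℤ) ℤ.+ sum s) ℤ.+ (sum δ₀ ℤ.+ sum δE)
        ≡⟨ cong₂ (λ i j → (i ℤ.+ sum s) ℤ.+ j) (sum-const p 1ℤ)
             (cong₂ ℤ._+_ (sum-scaled-δ (ℤ.- + 2) (# 0)) (sum-scaled-δ (ℤ.- 1ℤ) E)) ⟩
      (+ p ℤ.* 1ℤ ℤ.+ sum s) ℤ.+ (ℤ.- + 2 ℤ.+ ℤ.- 1ℤ)
        ≡⟨ solveℤ 2 (λ p s → (p ⊠ conℤ 1ℤ ⊞ s) ⊞ conℤ (ℤ.- + 3)
                       ≐ p ⊟ conℤ (+ 3) ⊞ s) refl (+ p) (sum s) ⟩
      + p ℤ.- + 3 ℤ.+ sum s ∎
      where
      s δ₀ δE : 𝔽 → ℤ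
      s w  = σ (Λ b E w)
      δ₀ w = ℤ.- + 2 ℤ.* ⟦ w ≟ # 0 ⟧
      δE w = ℤ.- 1ℤ ℤ.* ⟦ w ≟ E ⟧

  -- The case E = 0: two lines and a hyperbola

  module Nodal (C : 𝔽) where

    -- Setting y = -2 in (x - 2)(y - 2) = 2C gives -4(x - 2) = 2C, so `e` is where the line y = -2
    -- meets the hyperbola.
    e : 𝔽
    e = # 2 - C / # 2

    2*e : # 2 * e ≡ # 4 - C
    2*e = begin
      # 2 * (# 2 - C / # 2)        ≡⟨ solve 1 (λ h → :con (+ 2) :* (:con (+ 2) :- h) := :con (+ 4) :- :con (+ 2) :* h) refl (C / # 2) ⟩
      # 4 - # 2 * (C / # 2)        ≡⟨ cong (λ c → # 4 - c) (*-/-cancel 2≢0 C) ⟩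
      # 4 - C                      ∎

    K-factors : ∀ x y → K C (# 0) x y ≡ (x + # 2) * ((y + # 2) * ((x - # 2) * (y - # 2) - # 2 * C))
    K-factors = solve 3 (λ C x y → :K C (:con (+ 0)) x y :=
      (x :+ :con (+ 2)) :* ((y :+ :con (+ 2)) :* ((x :- :con (+ 2)) :* (y :- :con (+ 2)) :- :con (+ 2) :* C))) refl C

    -≡⇒+≡0 : ∀ {a} → a ≡ - # 2 → a + # 2 ≡ # 0
    -≡⇒+≡0 refl = -‿inverseˡ (# 2)

    +≡0⇒≡- : ∀ {a} → a + # 2 ≡ # 0 → a ≡ - # 2
    +≡0⇒≡- {a} eq = -≡0⇒≡ (trans (cong (λ c → a + c) (-‿involutive (# 2))) eq)

    2≢-2 : # 2 ≢ - # 2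
    2≢-2 eq = 4≢0 (trans (#-+ 2 2) (-≡⇒+≡0 eq))

    -- For C = 8 the hyperbola passes through (-2, -2), where the two lines cross. Its meeting with
    -- y = -2 then lies in the fibre x = -2, which is full anyway, so no point is lost; this yields
    -- the bracket of C = 8.
    -2≡e⇒C≡8 : - # 2 ≡ e → C ≡ # 8
    -2≡e⇒C≡8 eq = begin
      C                  ≡⟨ solve 1 (λ C → C := :con (+ 4) :- (:con (+ 4) :- C)) refl C ⟩
      # 4 - (# 4 - C)    ≡⟨ cong (λ c → # 4 - c) 2*e ⟨
      # 4 - # 2 * e      ≡⟨ cong (λ c → # 4 - # 2 * c) eq ⟨
      # 4 - # 2 * - # 2  ≡⟨ solve 0 (:con (+ 4) :- :con (+ 2) :* (:- :con (+ 2)) := :con (+ 8)) refl ⟩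
      # 8                ∎

    C≡8⇒-2≡e : C ≡ # 8 → - # 2 ≡ e
    C≡8⇒-2≡e eq = *-cancelˡ 2≢0 (begin
      # 2 * - # 2  ≡⟨ solve 0 (:con (+ 2) :* (:- :con (+ 2)) := :con (+ 4) :- :con (+ 8)) refl ⟩
      # 4 - # 8    ≡⟨ cong (λ c → # 4 - c) eq ⟨
      # 4 - C      ≡⟨ 2*e ⟨
      # 2 * e      ∎)

    2≡e⇒C≡0 : # 2 ≡ e → C ≡ # 0
    2≡e⇒C≡0 eq = begin
      C                  ≡⟨ solve 1 (λ C → C := :con (+ 4) :- (:con (+ 4) :- C)) refl C ⟩
      # 4 - (# 4 - C)    ≡⟨ cong (λ c → # 4 - c) 2*e ⟨
      # 4 - # 2 * e      ≡⟨ cong (λ c → # 4 - # 2 * c) eq ⟨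
      # 4 - # 2 * # 2    ≡⟨ solve 0 (:con (+ 4) :- :con (+ 2) :* :con (+ 2) := :con (+ 0)) refl ⟩
      # 0                ∎

    C≡0⇒2≡e : C ≡ # 0 → # 2 ≡ e
    C≡0⇒2≡e eq = *-cancelˡ 2≢0 (begin
      # 2 * # 2    ≡⟨ solve 0 (:con (+ 2) :* :con (+ 2) := :con (+ 4) :- :con (+ 0)) refl ⟩
      # 4 - # 0    ≡⟨ cong (λ c → # 4 - c) eq ⟨
      # 4 - C      ≡⟨ 2*e ⟨
      # 2 * e      ∎)

    count-y-full : count-y C (# 0) (- # 2) ≡ + p
    count-y-full = sum-all p (λ y → K C (# 0) (- # 2) y ≟ # 0) λ y → trans (K-factors (- # 2) y)
      (trans (cong (_* r y) (-‿inverseˡ (# 2))) (zeroˡ (r y)))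
      where
      r : 𝔽 → 𝔽
      r y = (y + # 2) * ((- # 2 - # 2) * (y - # 2) - # 2 * C)

    K-at-2 : ∀ y → K C (# 0) (# 2) y ≡ # 2 * # 4 * - C * (y + # 2)
    K-at-2 = solve 2 (λ C y → :K C (:con (+ 0)) (:con (+ 2)) y :=
      :con (+ 2) :* :con (+ 4) :* (:- C) :* (y :+ :con (+ 2))) refl C

    -- For C = 0 the hyperbola degenerates into the lines x = 2 and y = 2, and the first of them
    -- fills this fibre.
    count-y-2-C≡0 : C ≡ # 0 → count-y C (# 0) (# 2) ≡ + p
    count-y-2-C≡0 C≡0 = sum-all p (λ y → K C (# 0) (# 2) y ≟ # 0) λ y → begin
      K C (# 0) (# 2) y                ≡⟨ K-at-2 y ⟩
      # 2 * # 4 * - C * (y + # 2)      ≡⟨ cong (λ c → # 2 * # 4 * - c * (y + # 2)) C≡0 ⟩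
      # 2 * # 4 * - # 0 * (y + # 2)    ≡⟨ solve 1 (λ y → :con (+ 2) :* :con (+ 4) :* (:- :con (+ 0)) :* (y :+ :con (+ 2)) := :con (+ 0)) refl y ⟩
      # 0                              ∎

    -- For C ≠ 0 the line x = 2 is an asymptote: the hyperbola has no point on it, and only the line
    -- y = -2 contributes.
    count-y-2-C≢0 : C ≢ # 0 → count-y C (# 0) (# 2) ≡ 1ℤ
    count-y-2-C≢0 C≢0 = sum-unique (λ y → K C (# 0) (# 2) y ≟ # 0) (- # 2)
      (λ y K≡0 → +≡0⇒≡- (*-zero-factor (*-≢0 (*-≢0 2≢0 4≢0) -C≢0) (trans (sym (K-at-2 y)) K≡0)))
      (trans (K-at-2 (- # 2)) (trans (cong (# 2 * # 4 * - C *_) (-‿inverseˡ (# 2))) (zeroʳ (# 2 * # 4 * - C))))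
      where
      -C≢0 : - C ≢ # 0
      -C≢0 eq = C≢0 (trans (sym (-‿involutive C)) (trans (cong (λ c → - c) eq) #0-neg))

    module _ {x : 𝔽} (x≢-2 : x ≢ - # 2) (x≢2 : x ≢ # 2) where

      a = x - # 2
      a≢0 : a ≢ # 0
      a≢0 = x≢2 ∘ -≡0⇒≡

      y₀ : 𝔽
      y₀ = # 2 + # 2 * C / a

      hyperbola : ∀ y → a * (y - # 2) - # 2 * C ≡ a * (y - y₀)
      hyperbola y = begin
        a * (y - # 2) - # 2 * C              ≡⟨ cong (λ c → a * (y - # 2) - c) (*-/-cancel a≢0 (# 2 * C)) ⟨
        a * (y - # 2) - a * (# 2 * C / a)    ≡⟨ solve 3 (λ a y q → a :* (y :- :con (+ 2)) :- a :* q := a :* (y :- (:con (+ 2) :+ q))) refl a y (# 2 * C / a) ⟩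
        a * (y - y₀)                         ∎

      K-split : ∀ y → K C (# 0) x y ≡ (x + # 2) * ((y + # 2) * (a * (y - y₀)))
      K-split y = trans (K-factors x y) (cong (λ c → (x + # 2) * ((y + # 2) * c)) (hyperbola y))

      x+2≢0 : x + # 2 ≢ # 0
      x+2≢0 = x≢-2 ∘ +≡0⇒≡-

      roots : ∀ y → K C (# 0) x y ≡ # 0 → y ≡ - # 2 ⊎ y ≡ y₀
      roots y K≡0 = by-cases (y ≟ - # 2)
        where
        by-cases : Dec (y ≡ - # 2) → y ≡ - # 2 ⊎ y ≡ y₀
        by-cases (yes y≡-2) = inj₁ y≡-2
        by-cases (no y≢-2)  = inj₂ (-≡0⇒≡ (*-zero-factor a≢0 (*-zero-factor (y≢-2 ∘ +≡0⇒≡-)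
              (*-zero-factor x+2≢0 (trans (sym (K-split y)) K≡0)))))

      root-2 : ∀ y → y ≡ - # 2 → K C (# 0) x y ≡ # 0
      root-2 y y≡-2 = begin
        K C (# 0) x y                                 ≡⟨ K-split y ⟩
        (x + # 2) * ((y + # 2) * (a * (y - y₀)))      ≡⟨ cong (λ c → (x + # 2) * (c * (a * (y - y₀)))) (-≡⇒+≡0 y≡-2) ⟩
        (x + # 2) * (# 0 * (a * (y - y₀)))            ≡⟨ cong ((x + # 2) *_) (zeroˡ (a * (y - y₀))) ⟩
        (x + # 2) * # 0                               ≡⟨ zeroʳ (x + # 2) ⟩
        # 0                                           ∎

      root-y₀ : ∀ y → y ≡ y₀ → K C (# 0) x y ≡ # 0
      root-y₀ y y≡y₀ = begin
        K C (# 0) x y                                 ≡⟨ K-split y ⟩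
        (x + # 2) * ((y + # 2) * (a * (y - y₀)))      ≡⟨ cong (λ c → (x + # 2) * ((y + # 2) * (a * c))) (≡⇒-≡0 y≡y₀) ⟩
        (x + # 2) * ((y + # 2) * (a * # 0))           ≡⟨ solve 3 (λ u v a → u :* (v :* (a :* :con (+ 0))) := :con (+ 0)) refl (x + # 2) (y + # 2) a ⟩
        # 0                                           ∎

      -- Up to the factor -2, the hyperbola equation at y = -2 reads 2x - (4 - C) = 0; since 2e = 4
      -- - C, the two roots merge at x = e.
      coincidence : # 2 * x - (# 4 - C) ≡ # 0 → - # 2 ≡ y₀
      coincidence eq = -≡0⇒≡ (*-cancelˡ a≢0 (begin
        a * (- # 2 - y₀)             ≡⟨ hyperbola (- # 2) ⟨
        a * (- # 2 - # 2) - # 2 * C  ≡⟨ solve 2 (λ x C → (x :- :con (+ 2)) :* ((:- :con (+ 2)) :- :con (+ 2)) :- :con (+ 2) :* C := (:- :con (+ 2)) :* (:con (+ 2) :* x :- (:con (+ 4) :- C))) refl x C ⟩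
        - # 2 * (# 2 * x - (# 4 - C)) ≡⟨ cong (- # 2 *_) eq ⟩
        - # 2 * # 0                  ≡⟨ solve 1 (λ a → (:- :con (+ 2)) :* :con (+ 0) := a :* :con (+ 0)) refl a ⟩
        a * # 0                      ∎))

      coincidence⁻¹ : - # 2 ≡ y₀ → x ≡ e
      coincidence⁻¹ eq = *-cancelˡ 2≢0 (trans (-≡0⇒≡ (*-zero-factor 2≢0 (begin
        # 2 * (# 2 * x - (# 4 - C))      ≡⟨ solve 2 (λ x C → :con (+ 2) :* (:con (+ 2) :* x :- (:con (+ 4) :- C)) := :- ((x :- :con (+ 2)) :* ((:- :con (+ 2)) :- :con (+ 2)) :- :con (+ 2) :* C)) refl x C ⟩
        - (a * (- # 2 - # 2) - # 2 * C)  ≡⟨ cong (λ c → - c) (hyperbola (- # 2)) ⟩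
        - (a * (- # 2 - y₀))             ≡⟨ cong (λ c → - (a * c)) (≡⇒-≡0 eq) ⟩
        - (a * # 0)                      ≡⟨ solve 1 (λ a → :- (a :* :con (+ 0)) := :con (+ 0)) refl a ⟩
        # 0                              ∎))) (sym 2*e))

      count-y-tangent : x ≡ e → count-y C (# 0) x ≡ 1ℤ
      count-y-tangent x≡e = sum-unique (λ y → K C (# 0) x y ≟ # 0) (- # 2)
        (λ y K≡0 → [ (λ y≡-2 → y≡-2) , (λ y≡y₀ → trans y≡y₀ (sym y₀≡-2)) ]′ (roots y K≡0))
        (root-2 (- # 2) refl)
        where
        y₀≡-2 : - # 2 ≡ y₀
        y₀≡-2 = coincidence (≡⇒-≡0 (trans (cong (# 2 *_) x≡e) 2*e))

      count-y-generic : x ≢ e → count-y C (# 0) x ≡ + 2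
      count-y-generic x≢e = begin
        count-y C (# 0) x
          ≡⟨ sum-cong-≗ (λ y → ⟦⟧-⊎ (K C (# 0) x y ≟ # 0) (y ≟ - # 2) (y ≟ y₀) (roots y) (root-2 y) (root-y₀ y)
               λ (y≡-2 , y≡y₀) → x≢e (coincidence⁻¹ (trans (sym y≡-2) y≡y₀))) ⟩
        sum (λ y → ⟦ y ≟ - # 2 ⟧ ℤ.+ ⟦ y ≟ y₀ ⟧)
          ≡⟨ ∑-distrib-+ (λ y → ⟦ y ≟ - # 2 ⟧) (λ y → ⟦ y ≟ y₀ ⟧) ⟩
        sum (λ y → ⟦ y ≟ - # 2 ⟧) ℤ.+ sum (λ y → ⟦ y ≟ y₀ ⟧)
          ≡⟨ cong₂ ℤ._+_ (sum-δ (- # 2)) (sum-δ y₀) ⟩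
        + 2 ∎

    -- The right-hand side of `count-y-formula` in solver syntax, with the brackets as variables.
    -- Each coefficient is a deviation from two points: p - 2 over x = -2; -1 over x = 2, or p - 2
    -- if C = 0; and -1 over x = e, cancelled for C = 0 and C = 8, when e falls on one of the other
    -- two.
    formula : ∀ {n} → (p δ₁ δ₂ δ₃ c₀ c₈ : ℤ-Polynomial n) → ℤ-Polynomial n
    formula p δ₁ δ₂ δ₃ c₀ c₈ = conℤ (+ 2) ⊞ ((p ⊟ conℤ (+ 2)) ⊠ δ₁
      ⊞ (((p ⊟ conℤ 1ℤ) ⊠ c₀ ⊟ conℤ 1ℤ) ⊠ δ₂ ⊞ (c₈ ⊞ c₀ ⊟ conℤ 1ℤ) ⊠ δ₃))

    -- Generic fibres have two points, y = -2 and one on the hyperbola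
    -- (x - 2)(y - 2) = 2C; these merge for x = e.
    count-y-formula : ∀ x (d₁ : Dec (x ≡ - # 2)) (d₂ : Dec (x ≡ # 2)) (d₃ : Dec (x ≡ e))
      (d₀ : Dec (C ≡ # 0)) (d₈ : Dec (C ≡ # 8)) → count-y C (# 0) x ≡
      + 2 ℤ.+ ((+ p ℤ.- + 2) ℤ.* ⟦ d₁ ⟧ ℤ.+ (((+ p ℤ.- 1ℤ) ℤ.* ⟦ d₀ ⟧ ℤ.- 1ℤ) ℤ.* ⟦ d₂ ⟧
        ℤ.+ (⟦ d₈ ⟧ ℤ.+ ⟦ d₀ ⟧ ℤ.- 1ℤ) ℤ.* ⟦ d₃ ⟧))
    count-y-formula x (yes refl) (yes -2≡2) _ _ _ = contradiction (sym -2≡2) 2≢-2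
    count-y-formula x (yes refl) (no _) (yes -2≡e) (yes C≡0) _ =
      contradiction (trans (sym (-2≡e⇒C≡8 -2≡e)) C≡0) 8≢0
    count-y-formula x (yes refl) (no _) (yes -2≡e) (no _) (no C≢8) =
      contradiction (-2≡e⇒C≡8 -2≡e) C≢8
    count-y-formula x (yes refl) (no _) (yes _) (no _) (yes _) =
      trans count-y-full (solveℤ 1 (λ p → p ≐ formula p (conℤ 1ℤ) (conℤ 0ℤ) (conℤ 1ℤ) (conℤ 0ℤ) (conℤ 1ℤ)) refl (+ p))
    count-y-formula x (yes refl) (no _) (no _) d₀ d₈ =
      trans count-y-full (solveℤ 3 (λ p c₀ c₈ → p ≐ formula p (conℤ 1ℤ) (conℤ 0ℤ) (conℤ 0ℤ) c₀ c₈) refl (+ p) ⟦ d₀ ⟧ ⟦ d₈ ⟧)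
    count-y-formula x (no _) (yes refl) (yes 2≡e) (no C≢0) _ = contradiction (2≡e⇒C≡0 2≡e) C≢0
    count-y-formula x (no _) (yes refl) (yes _) (yes C≡0) (yes C≡8) = contradiction (trans (sym C≡8) C≡0) 8≢0
    count-y-formula x (no _) (yes refl) (yes _) (yes C≡0) (no _) =
      trans (count-y-2-C≡0 C≡0) (solveℤ 1 (λ p → p ≐ formula p (conℤ 0ℤ) (conℤ 1ℤ) (conℤ 1ℤ) (conℤ 1ℤ) (conℤ 0ℤ)) refl (+ p))
    count-y-formula x (no _) (yes refl) (no 2≢e) (yes C≡0) _ = contradiction (C≡0⇒2≡e C≡0) 2≢e
    count-y-formula x (no _) (yes refl) (no _) (no C≢0) d₈ =
      trans (count-y-2-C≢0 C≢0) (solveℤ 2 (λ p c₈ → conℤ 1ℤ ≐ formula p (conℤ 0ℤ) (conℤ 1ℤ) (conℤ 0ℤ) (conℤ 0ℤ) c₈) refl (+ p) ⟦ d₈ ⟧)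
    count-y-formula x (no _) (no x≢2) (yes x≡e) (yes C≡0) _ = contradiction (trans x≡e (sym (C≡0⇒2≡e C≡0))) x≢2
    count-y-formula x (no x≢-2) (no _) (yes x≡e) (no _) (yes C≡8) = contradiction (trans x≡e (sym (C≡8⇒-2≡e C≡8))) x≢-2
    count-y-formula x (no x≢-2) (no x≢2) (yes x≡e) (no _) (no _) =
      trans (count-y-tangent x≢-2 x≢2 x≡e) (solveℤ 1 (λ p → conℤ 1ℤ ≐ formula p (conℤ 0ℤ) (conℤ 0ℤ) (conℤ 1ℤ) (conℤ 0ℤ) (conℤ 0ℤ)) refl (+ p))
    count-y-formula x (no x≢-2) (no x≢2) (no x≢e) d₀ d₈ =
      trans (count-y-generic x≢-2 x≢2 x≢e)
        (solveℤ 3 (λ p c₀ c₈ → conℤ (+ 2) ≐ formula p (conℤ 0ℤ) (conℤ 0ℤ) (conℤ 0ℤ) c₀ c₈) refl (+ p) ⟦ d₀ ⟧ ⟦ d₈ ⟧)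

    sum-count-y : sum (count-y C (# 0)) ≡ (+ 3 ℤ.+ ⟦ C ≟ # 0 ⟧) ℤ.* + p ℤ.- + 4 ℤ.+ ⟦ C ≟ # 8 ⟧
    sum-count-y = begin
      sum (count-y C (# 0))
        ≡⟨ sum-cong-≗ (λ x → count-y-formula x (x ≟ - # 2) (x ≟ # 2) (x ≟ e) (C ≟ # 0) (C ≟ # 8)) ⟩
      sum (λ x → + 2 ℤ.+ (δ₁ x ℤ.+ (δ₂ x ℤ.+ δ₃ x)))
        ≡⟨ ∑-distrib-+ {p} (λ _ → + 2) (λ x → δ₁ x ℤ.+ (δ₂ x ℤ.+ δ₃ x)) ⟩
      sum {p} (λ _ → + 2) ℤ.+ sum (λ x → δ₁ x ℤ.+ (δ₂ x ℤ.+ δ₃ x))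
        ≡⟨ cong₂ ℤ._+_ (sum-const p (+ 2))
             (trans (∑-distrib-+ δ₁ (λ x → δ₂ x ℤ.+ δ₃ x)) (cong₂ ℤ._+_ (sum-scaled-δ α (- # 2))
               (trans (∑-distrib-+ δ₂ δ₃) (cong₂ ℤ._+_ (sum-scaled-δ β (# 2)) (sum-scaled-δ γ e))))) ⟩
      + p ℤ.* + 2 ℤ.+ (α ℤ.+ (β ℤ.+ γ))
        ≡⟨ solveℤ 3 (λ p c₀ c₈ → p ⊠ conℤ (+ 2) ⊞ ((p ⊟ conℤ (+ 2)) ⊞
             (((p ⊟ conℤ 1ℤ) ⊠ c₀ ⊟ conℤ 1ℤ) ⊞ (c₈ ⊞ c₀ ⊟ conℤ 1ℤ))) ≐
             (conℤ (+ 3) ⊞ c₀) ⊠ p ⊟ conℤ (+ 4) ⊞ c₈) refl (+ p) ⟦ C ≟ # 0 ⟧ ⟦ C ≟ # 8 ⟧ ⟩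
      (+ 3 ℤ.+ ⟦ C ≟ # 0 ⟧) ℤ.* + p ℤ.- + 4 ℤ.+ ⟦ C ≟ # 8 ⟧ ∎
      where
      α β γ : ℤ
      α = + p ℤ.- + 2
      β = (+ p ℤ.- 1ℤ) ℤ.* ⟦ C ≟ # 0 ⟧ ℤ.- 1ℤ
      γ = ⟦ C ≟ # 8 ⟧ ℤ.+ ⟦ C ≟ # 0 ⟧ ℤ.- 1ℤ
      δ₁ δ₂ δ₃ : 𝔽 → ℤ
      δ₁ x = α ℤ.* ⟦ x ≟ - # 2 ⟧
      δ₂ x = β ℤ.* ⟦ x ≟ # 2 ⟧
      δ₃ x = γ ℤ.* ⟦ x ≟ e ⟧

theorem7p1 : (p : ℕ) → .{{_ : NonZero p}} → Prime p → 5 ≤ p →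
    let open ResidueField p in
    (C D : 𝔽) →
    (D ≡ D• C →
    + N₁ (f C D) ≡ (+ 3 ℤ.+ ⟦ C ≟ # 0 ⟧) ℤ.* + p ℤ.- + 4 ℤ.+ ⟦ C ≟ # 8 ⟧)
    × (D ≢ D• C →
    + N₁ (f C D) ≡ + p ℤ.- + 3 ℤ.+ sum (λ x → σ (cubic C D x)))
theorem7p1 p p-prime 5≤p C D = nodal , smooth
  where
  open ResidueField p
  2<p : 2 < p
  2<p = ℕ.<-≤-trans (ℕ.s≤s (ℕ.s≤s (ℕ.s≤s ℕ.z≤n))) 5≤p
  open OddPrimeField p p-prime 2<p
  open DiscriminantCurve p p-prime 2<p
  nodal : D ≡ D• C → + N₁ (f C D) ≡ (+ 3 ℤ.+ ⟦ C ≟ # 0 ⟧) ℤ.* + p ℤ.- + 4 ℤ.+ ⟦ C ≟ # 8 ⟧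
  nodal D≡D• = trans (N₁-as-sum C D)
    (trans (cong (λ E → sum (count-y C E)) (≡⇒-≡0 D≡D•)) (Nodal.sum-count-y C))
  smooth : D ≢ D• C → + N₁ (f C D) ≡ + p ℤ.- + 3 ℤ.+ sum (λ x → σ (cubic C D x))
  smooth D≢D• = trans (N₁-as-sum C D)
    (Smooth.sum-count-y C (D - D• C) (λ E≡0 → D≢D• (-≡0⇒≡ E≡0)))
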